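{- If a structure $\mathcal{N}$ interprets a structure $\mathcal{M}$ then $\mathcal{N}$ trace defines $\mathcal{M}$. If a theory $T$ interprets a theory $T^*$ then $T$ trace defines $T^*$. Mutually interpretable structures or theories are trace equivalent.
   Context: Conventions: structures and theories are first order; theories are complete and consistent; "definable" means definable with parameters, and interpretations are allowed to use parameters. Two structures or theories are mutually interpretable if each interprets the other. $\mathcal{N}$ trace defines $\mathcal{M}$ if for some $n\ge 1$ there is a map $\tau\colon M\to N^n$ such that for every $m\ge 1$ and every $\mathcal{M}$-definable $X\subseteq M^m$ there is an $\mathcal{N}$-definable $Y\subseteq N^{mn}$ with $X=\{(a_1,\dots,a_m)\in M^m : (\tau(a_1),\dots,\tau(a_m))\in Y\}$. $T$ trace defines $\mathcal{M}$ if some model of $T$ does; $T$ trace defines $T^*$ if $T$ trace defines every model of $T^*$. Two theories are trace equivalent if each trace defines the other; two structures are trace equivalent if their theories are. -}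

module Defs where

open import Axiom.ExcludedMiddle using (ExcludedMiddle)
open import Axiom.Extensionality.Propositional using (Extensionality)
open import Data.Fin.Base using (Fin)
open import Data.Nat.Base using (ℕ; _+_; _*_; _≤_)
open import Data.Product.Base using (Σ-syntax; ∃-syntax; _×_)
open import Data.Sum.Base using (_⊎_)
open import Data.Vec.Base using (Vec; []; _∷_; _++_; concat; lookup; map)
open import Data.Vec.Relation.Unary.All using (All; reduce)
open import Function.Bundles using (_⇔_)
open import Level using (Level; Setω)
open import Relation.Binary.PropositionalEquality.Core using (_≡_)
open import Relation.Nullary.Negation.Core using (¬_)
open import Relation.Unary using (Pred)

-- The classical metatheory in which model theory is carried out.  Excluded
-- middle is for arbitrary types rather than just propositions, so it also
-- supplies choice functions; with function extensionality these can be made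
-- to depend only on the equivalence class of their argument.
record Classical : Setω where
  field
    excluded-middle : ∀ {a} → ExcludedMiddle a
    extensionality  : ∀ {a b} → Extensionality a b

record Language ℓ : Set (Level.suc ℓ) where
  field
    Function : ℕ → Set ℓ
    Relation : ℕ → Set ℓ

open Language public

-- Set ℓ plays the role of the universe of sets: languages, structures and
-- definable sets all live in it.  Structures are nonempty.
record Structure {ℓ} (L : Language ℓ) : Set (Level.suc ℓ) where
  field
    Carrier  : Set ℓ
    nonempty : Carrier
    function : ∀ {k} → Function L k → Vec Carrier k → Carrier
    relation : ∀ {k} → Relation L k → Pred (Vec Carrier k) ℓ

open Structure public

private
  variable
    ℓ : Level

-- Terms and formulas with free variables among v₀ , … , vₖ₋₁.
data Term (L : Language ℓ) (k : ℕ) : Set ℓ where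
  var : Fin k → Term L k
  app : ∀ {r} → Function L r → Vec (Term L k) r → Term L k

-- The remaining connectives and ∀ are the usual classical abbreviations.
-- The variable bound by exists is v₀ of its body.
data Formula (L : Language ℓ) (k : ℕ) : Set ℓ where
  equal  : Term L k → Term L k → Formula L k
  rel    : ∀ {r} → Relation L r → Vec (Term L k) r → Formula L k
  not    : Formula L k → Formula L k
  and    : Formula L k → Formula L k → Formula L k
  exists : Formula L (ℕ.suc k) → Formula L k

Sentence : Language ℓ → Set ℓ
Sentence L = Formula L 0

module _ {L : Language ℓ} (M : Structure L) where

  mutual
    ⟦_⟧ : ∀ {k} → Term L k → Vec (Carrier M) k → Carrier M
    ⟦ var x ⟧ ρ    = lookup ρ x
    ⟦ app f ts ⟧ ρ = function M f (⟦ ts ⟧* ρ)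

    ⟦_⟧* : ∀ {k r} → Vec (Term L k) r → Vec (Carrier M) k → Vec (Carrier M) r
    ⟦ [] ⟧* ρ     = []
    ⟦ t ∷ ts ⟧* ρ = ⟦ t ⟧ ρ ∷ ⟦ ts ⟧* ρ

  Satisfies : ∀ {k} → Formula L k → Pred (Vec (Carrier M) k) ℓ
  Satisfies (equal s t) ρ = ⟦ s ⟧ ρ ≡ ⟦ t ⟧ ρ
  Satisfies (rel R ts)  ρ = relation M R (⟦ ts ⟧* ρ)
  Satisfies (not φ)     ρ = ¬ Satisfies φ ρ
  Satisfies (and φ ψ)   ρ = Satisfies φ ρ × Satisfies ψ ρ
  Satisfies (exists φ)  ρ = ∃[ x ] Satisfies φ (x ∷ ρ)

  -- Definable with parameters c.
  Definable : ∀ {m} → Pred (Vec (Carrier M) m) ℓ → Set ℓ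
  Definable {m} X =
    ∃[ k ] Σ[ φ ∈ Formula L (m + k) ] Σ[ c ∈ Vec (Carrier M) k ]
      (∀ a → X a ⇔ Satisfies φ (a ++ c))

infix 4 _⊨_

_⊨_ : {L : Language ℓ} → Structure L → Sentence L → Set ℓ
M ⊨ σ = Satisfies M σ []

Theory : Language ℓ → Set (Level.suc ℓ)
Theory {ℓ} L = Pred (Sentence L) ℓ

Model : {L : Language ℓ} → Theory L → Structure L → Set ℓ
Model T M = ∀ σ → T σ → M ⊨ σ

Entails : {L : Language ℓ} → Theory L → Sentence L → Set (Level.suc ℓ)
Entails {L = L} T σ = (M : Structure L) → Model T M → M ⊨ σ

-- Consistency and completeness are semantic (equivalent to the deductive
-- notions by the completeness theorem).
Consistent : {L : Language ℓ} → Theory L → Set (Level.suc ℓ)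
Consistent T = ∃[ M ] Model T M

Complete : {L : Language ℓ} → Theory L → Set (Level.suc ℓ)
Complete T = ∀ σ → Entails T σ ⊎ Entails T (not σ)

Th : {L : Language ℓ} → Structure L → Theory L
Th M σ = M ⊨ σ

Diagonal : (A : Set ℓ) → Pred (Vec A 2) ℓ
Diagonal A (x ∷ y ∷ []) = x ≡ y

-- The value is the first coordinate of the graph.
Graph : {A : Set ℓ} {k : ℕ} → (Vec A k → A) → Pred (Vec A (ℕ.suc k)) ℓ
Graph f (y ∷ xs) = f xs ≡ y

-- An interpretation of M in N: a surjection from a definable subset of N^dim
-- onto M which pulls back equality, the graphs of the basic functions and the
-- basic relations of M to definable sets of N.
record Interpretation {L L′ : Language ℓ} (N : Structure L) (M : Structure L′)
       : Set (Level.suc ℓ) where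
  field
    dim              : ℕ
    dim≥1            : 1 ≤ dim
    Domain           : Pred (Vec (Carrier N) dim) ℓ
    domain-definable : Definable N Domain
    -- Irrelevance: the value does not depend on the proof of membership.
    to               : (a : Vec (Carrier N) dim) → .(Domain a) → Carrier M
    surjective       : ∀ b → Σ[ a ∈ _ ] Σ[ a∈D ∈ Domain a ] to a a∈D ≡ b

  Pullback : ∀ {m} → Pred (Vec (Carrier M) m) ℓ →
             Pred (Vec (Vec (Carrier N) dim) m) ℓ
  Pullback X as =
    Σ[ as∈D ∈ All Domain as ] X (reduce (λ {a} a∈D → to a a∈D) as∈D)

  -- concat identifies (N^dim)^m with N^(m * dim).
  PullbackDefinable : ∀ {m} → Pred (Vec (Carrier M) m) ℓ → Set (Level.suc ℓ)
  PullbackDefinable {m} X =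
    Σ[ Y ∈ Pred (Vec (Carrier N) (m * dim)) ℓ ]
      Definable N Y × (∀ as → Pullback X as ⇔ Y (concat as))

  field
    equality-definable : PullbackDefinable (Diagonal (Carrier M))
    function-definable : ∀ {k} (f : Function L′ k) →
                         PullbackDefinable (Graph (function M f))
    relation-definable : ∀ {k} (R : Relation L′ k) →
                         PullbackDefinable (relation M R)

Interprets : {L L′ : Language ℓ} → Structure L → Structure L′ → Set (Level.suc ℓ)
Interprets N M = Interpretation N M

TraceDefines : {L L′ : Language ℓ} → Structure L → Structure L′ →
               Set (Level.suc ℓ)
TraceDefines {ℓ} N M =
  ∃[ n ] 1 ≤ n × Σ[ τ ∈ (Carrier M → Vec (Carrier N) n) ]
    (∀ m → 1 ≤ m → (X : Pred (Vec (Carrier M) m) ℓ) → Definable M X →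
      Σ[ Y ∈ Pred (Vec (Carrier N) (m * n)) ℓ ]
        Definable N Y × (∀ a → X a ⇔ Y (concat (map τ a))))

-- Some model of T interprets some model of T′.  For consistent theories this
-- is implied by the variants in which one or both of "some" is "every".
TheoryInterprets : {L L′ : Language ℓ} → Theory L → Theory L′ →
                   Set (Level.suc ℓ)
TheoryInterprets T T′ =
  ∃[ N ] Model T N × (∃[ M ] Model T′ M × Interprets N M)

TheoryTraceDefinesStructure : {L L′ : Language ℓ} → Theory L → Structure L′ →
                              Set (Level.suc ℓ)
TheoryTraceDefinesStructure T M = ∃[ N ] Model T N × TraceDefines N M

TheoryTraceDefines : {L L′ : Language ℓ} → Theory L → Theory L′ →
                     Set (Level.suc ℓ)
TheoryTraceDefines T T′ = ∀ M → Model T′ M → TheoryTraceDefinesStructure T M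

MutuallyInterpretable : {L L′ : Language ℓ} → Structure L → Structure L′ →
                        Set (Level.suc ℓ)
MutuallyInterpretable M N = Interprets M N × Interprets N M

TheoriesMutuallyInterpretable : {L L′ : Language ℓ} → Theory L → Theory L′ →
                                Set (Level.suc ℓ)
TheoriesMutuallyInterpretable T T′ =
  TheoryInterprets T T′ × TheoryInterprets T′ T

TheoriesTraceEquivalent : {L L′ : Language ℓ} → Theory L → Theory L′ →
                          Set (Level.suc ℓ)
TheoriesTraceEquivalent T T′ = TheoryTraceDefines T T′ × TheoryTraceDefines T′ T

TraceEquivalent : {L L′ : Language ℓ} → Structure L → Structure L′ →
                  Set (Level.suc ℓ)
TraceEquivalent M N = TheoriesTraceEquivalent (Th M) (Th N)

{-# OPTIONS --safe #-}
module Submission where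

-- An interpretation of M in N lets every formula true of a tuple in M be
-- translated into a formula, with parameters, true of the tuple of codes in N,
-- so a choice of codes trace defines M.  For theories, let N ⊨ T interpret
-- M ⊨ T′ and let M′ be another model of T′.  As T′ is complete, every formula
-- true of a tuple of M′ is true in M of the image of the tuple under some map
-- M′ → M.  Hence some ultrafilter on the set of these maps contains
-- { i | M ⊨ φ(i b) } exactly when M′ ⊨ φ(b).  In the ultrapower of N along it,
-- which is a model of T by Łoś's theorem, sending b to the class of
-- i ↦ code (i b) trace defines M′.

open import Defs
open import Axiom.ExcludedMiddle using (ExcludedMiddle)
open import Data.Bool.Base using (Bool; T)
open import Data.Bool.Properties using (T-≡; ⇔→≡)
open import Data.Empty using (⊥)
open import Data.Fin.Base as Fin using (Fin; zero; suc; combine; remQuot; splitAt; _↑ˡ_; _↑ʳ_)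
open import Data.Fin.Properties using (combine-remQuot; splitAt-↑ˡ; splitAt-↑ʳ)
open import Data.List.Base as List using (List)
open import Data.List.Relation.Unary.All as ListAll using ([]; _∷_)
import Data.List.Relation.Unary.All.Properties as ListAllₚ
open import Data.Nat.Base using (ℕ; zero; suc; _+_; _*_; _≤_)
open import Data.Product.Base using (Σ-syntax; ∃-syntax; _×_; _,_; proj₁; proj₂; map₂; uncurry)
open import Data.Product.Function.NonDependent.Propositional using (_×-⇔_)
open import Data.Sum.Base using (_⊎_; inj₁; inj₂; [_,_]′; map₁)
open import Data.Vec.Base using (Vec; []; _∷_; _++_; concat; lookup; map; tabulate)
open import Data.Vec.Properties
  using (lookup-++ˡ; lookup-++ʳ; lookup-concat; lookup-map; lookup-splitAt;
         lookup∘tabulate; tabulate∘lookup; tabulate-cong; map-cong; map-∘; map-id)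
open import Data.Vec.Relation.Unary.All as All using (All; []; _∷_; reduce)
import Data.Vec.Relation.Unary.All.Properties as Allₚ
open import Function.Base using (id; _∘_; const)
open import Function.Bundles using (_⇔_; mk⇔; Equivalence)
open import Function.Properties.Equivalence using () renaming (sym to ⇔-sym; trans to ⇔-trans)
open import Function.Related.Propositional using (≡⇒)
open import Function.Related.TypeIsomorphisms using (¬-cong-⇔)
open import Level using (Level; Lift; lift)
open import Relation.Binary.PropositionalEquality
  using (_≡_; refl; sym; trans; cong; cong₂; subst)
open import Relation.Nullary.Decidable.Core
  using (yes; no; isYes; toWitness; fromWitness; recompute; decidable-stable)
open import Relation.Nullary.Negation.Core using (¬_; contradiction)
open import Relation.Unary using (Pred)

open Equivalence using (to; from)

private
  variable
    ℓ : Level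
    A B : Set ℓ
    d j k m n r : ℕ

lookup-extensionality : {xs ys : Vec A n} → (∀ i → lookup xs i ≡ lookup ys i) → xs ≡ ys
lookup-extensionality {xs = xs} {ys} eq =
  trans (sym (tabulate∘lookup xs)) (trans (tabulate-cong eq) (tabulate∘lookup ys))

-- Renaming of variables and blocks of quantifiers.

module _ {L : Language ℓ} where

  mutual
    renameTerm : (Fin j → Fin k) → Term L j → Term L k
    renameTerm h (var x)    = var (h x)
    renameTerm h (app f ts) = app f (renameTerms h ts)

    renameTerms : (Fin j → Fin k) → Vec (Term L j) r → Vec (Term L k) r
    renameTerms h []       = []
    renameTerms h (t ∷ ts) = renameTerm h t ∷ renameTerms h ts

  rename : (Fin j → Fin k) → Formula L j → Formula L k
  rename h (equal s t) = equal (renameTerm h s) (renameTerm h t)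
  rename h (rel R ts)  = rel R (renameTerms h ts)
  rename h (not φ)     = not (rename h φ)
  rename h (and φ ψ)   = and (rename h φ) (rename h ψ)
  rename h (exists φ)  = exists (rename (Fin.lift 1 h) φ)

  -- The innermost quantifier binds v₀, so the tuple of witnesses is prefixed to the valuation in
  -- its own order.
  exists^ : ∀ d → Formula L (d + k) → Formula L k
  exists^ zero    φ = φ
  exists^ (suc d) φ = exists^ d (exists φ)

module _ {L : Language ℓ} (N : Structure L) where

  mutual
    ⟦renameTerm⟧ : (h : Fin j → Fin k) (t : Term L j) {ρ : Vec (Carrier N) j} {ρ′ : Vec (Carrier N) k} →
                   (∀ x → lookup ρ′ (h x) ≡ lookup ρ x) →
                   ⟦_⟧ N (renameTerm h t) ρ′ ≡ ⟦_⟧ N t ρ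
    ⟦renameTerm⟧ h (var x)    eq = eq x
    ⟦renameTerm⟧ h (app f ts) eq = cong (function N f) (⟦renameTerms⟧ h ts eq)

    ⟦renameTerms⟧ : (h : Fin j → Fin k) (ts : Vec (Term L j) r) {ρ : Vec (Carrier N) j} {ρ′ : Vec (Carrier N) k} →
                    (∀ x → lookup ρ′ (h x) ≡ lookup ρ x) →
                    ⟦_⟧* N (renameTerms h ts) ρ′ ≡ ⟦_⟧* N ts ρ
    ⟦renameTerms⟧ h []       eq = refl
    ⟦renameTerms⟧ h (t ∷ ts) eq = cong₂ _∷_ (⟦renameTerm⟧ h t eq) (⟦renameTerms⟧ h ts eq)

  -- The valuations are related only pointwise, so the hypothesis can be re-established under a
  -- binder and serves concatenated and tabulated tuples alike.
  satisfies-rename : (h : Fin j → Fin k) (φ : Formula L j) {ρ : Vec (Carrier N) j} {ρ′ : Vec (Carrier N) k} →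
                     (∀ x → lookup ρ′ (h x) ≡ lookup ρ x) →
                     Satisfies N (rename h φ) ρ′ ⇔ Satisfies N φ ρ
  satisfies-rename h (equal s t) eq =
    ≡⇒ (cong₂ _≡_ (⟦renameTerm⟧ h s eq) (⟦renameTerm⟧ h t eq))
  satisfies-rename h (rel R ts)  eq = ≡⇒ (cong (relation N R) (⟦renameTerms⟧ h ts eq))
  satisfies-rename h (not φ)     eq = ¬-cong-⇔ (satisfies-rename h φ eq)
  satisfies-rename h (and φ ψ)   eq = satisfies-rename h φ eq ×-⇔ satisfies-rename h ψ eq
  satisfies-rename h (exists φ)  eq =
    mk⇔ (map₂ (to (satisfies-rename (Fin.lift 1 h) φ lifted)))
        (map₂ (from (satisfies-rename (Fin.lift 1 h) φ lifted)))
    where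
    lifted : ∀ {a} x → lookup (a ∷ _) (Fin.lift 1 h x) ≡ lookup (a ∷ _) x
    lifted zero    = refl
    lifted (suc x) = eq x

  satisfies-exists^ : ∀ d (φ : Formula L (d + k)) {ρ : Vec (Carrier N) k} →
                      Satisfies N (exists^ d φ) ρ ⇔ (∃[ v ] Satisfies N φ (v ++ ρ))
  satisfies-exists^ zero    φ = mk⇔ ([] ,_) (λ { ([] , p) → p })
  satisfies-exists^ (suc d) φ = ⇔-trans (satisfies-exists^ d (exists φ))
    (mk⇔ (λ (v , a , p) → a ∷ v , p) (λ { (a ∷ v , p) → v , a , p }))

-- Formulas with named variables and parameters.

-- A formula each of whose free variables stands for a variable in V or for a
-- parameter in P, so that substitution acts on the valuation only.
record FormulaOver (L : Language ℓ) (V : Set) (P : Set ℓ) : Set ℓ where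
  constructor _at_
  field
    {arity} : ℕ
    formula : Formula L arity
    source  : Fin arity → V ⊎ P

open FormulaOver

private
  variable
    L : Language ℓ
    V W : Set
    P Q : Set ℓ

Holds : (N : Structure L) → FormulaOver L V P → (V → Carrier N) → (P → Carrier N) → Set _
Holds N (φ at s) ρ δ = Satisfies N φ (tabulate ([ ρ , δ ]′ ∘ s))

substitute : (V ⊎ P → W ⊎ Q) → FormulaOver L V P → FormulaOver L W Q
substitute g (φ at s) = φ at (g ∘ s)

negation : FormulaOver L V P → FormulaOver L V P
negation (φ at s) = not φ at s

conjunction : FormulaOver L V P → FormulaOver L V P → FormulaOver L V P
conjunction (_at_ {j} φ s) (_at_ {k} ψ t) =
  and (rename (_↑ˡ k) φ) (rename (j ↑ʳ_) ψ) at ([ s , t ]′ ∘ splitAt j)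

entry : Vec (Vec A d) m → Fin m × Fin d → A
entry as (i , j) = lookup (lookup as i) j

module _ {P : Set ℓ} {d m : ℕ} where

  -- A position becomes bound exactly when its source is a coordinate of the quantified tuple. Any
  -- other position x keeps its own index, shifted past the d bound variables.
  boundIndex : ∀ k → (Fin (suc m) × Fin d) ⊎ P → Fin k → Fin (d + k)
  boundIndex k (inj₁ (zero , j)) _ = j ↑ˡ k
  boundIndex k _                 x = d ↑ʳ x

  -- Bound variables get the irrelevant value p.
  freeSource : P → (Fin (suc m) × Fin d) ⊎ P → (Fin m × Fin d) ⊎ P
  freeSource p (inj₁ (zero , j))  = inj₂ p
  freeSource p (inj₁ (suc i , j)) = inj₁ (i , j)
  freeSource p (inj₂ q)           = inj₂ q

  existsBlock : P → FormulaOver L (Fin (suc m) × Fin d) P → FormulaOver L (Fin m × Fin d) P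
  existsBlock p (_at_ {k} φ s) =
    exists^ d (rename (λ x → boundIndex k (s x) x) φ) at (freeSource p ∘ s)

module _ {L : Language ℓ} (N : Structure L) where

  Holds-substitute : (g : V ⊎ P → W ⊎ Q) (S : FormulaOver L V P) {ρ : V → Carrier N} {δ : P → Carrier N}
                     {ρ′ : W → Carrier N} {δ′ : Q → Carrier N} →
                     (∀ x → [ ρ′ , δ′ ]′ (g x) ≡ [ ρ , δ ]′ x) →
                     Holds N (substitute g S) ρ′ δ′ ⇔ Holds N S ρ δ
  Holds-substitute g (φ at s) eq = ≡⇒ (cong (Satisfies N φ) (tabulate-cong (eq ∘ s)))

  Holds-conjunction : (S T : FormulaOver L V P) {ρ : V → Carrier N} {δ : P → Carrier N} →
                      Holds N (conjunction S T) ρ δ ⇔ (Holds N S ρ δ × Holds N T ρ δ)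
  Holds-conjunction (_at_ {j} φ s) (_at_ {k} ψ t) {ρ} {δ} =
    satisfies-rename N (_↑ˡ k) φ left ×-⇔ satisfies-rename N (j ↑ʳ_) ψ right
    where
    v = [ ρ , δ ]′

    left : ∀ x → lookup (tabulate (v ∘ [ s , t ]′ ∘ splitAt j)) (x ↑ˡ k) ≡ lookup (tabulate (v ∘ s)) x
    left x = trans (lookup∘tabulate _ (x ↑ˡ k))
      (trans (cong (v ∘ [ s , t ]′) (splitAt-↑ˡ j x k)) (sym (lookup∘tabulate _ x)))

    right : ∀ x → lookup (tabulate (v ∘ [ s , t ]′ ∘ splitAt j)) (j ↑ʳ x) ≡ lookup (tabulate (v ∘ t)) x
    right x = trans (lookup∘tabulate _ (j ↑ʳ x))
      (trans (cong (v ∘ [ s , t ]′) (splitAt-↑ʳ j k x)) (sym (lookup∘tabulate _ x)))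

  Holds-existsBlock : (p : P) (S : FormulaOver L (Fin (suc m) × Fin d) P)
                      {as : Vec (Vec (Carrier N) d) m} {δ : P → Carrier N} →
                      Holds N (existsBlock p S) (entry as) δ ⇔ (∃[ a ] Holds N S (entry (a ∷ as)) δ)
  Holds-existsBlock {d = d} p (_at_ {k} φ s) {as} {δ} = ⇔-trans (satisfies-exists^ N d _)
    (mk⇔ (map₂ (to (satisfies-rename N _ φ split))) (map₂ (from (satisfies-rename N _ φ split))))
    where
    module _ {a : Vec (Carrier N) d} where
      free = tabulate ([ entry as , δ ]′ ∘ freeSource p ∘ s)

      -- The source `s x` is generalised to y so that it can be split into cases while `free` stays
      -- tabulated from `s`.
      split′ : ∀ x y → lookup free x ≡ [ entry as , δ ]′ (freeSource p y) →
               lookup (a ++ free) (boundIndex k y x) ≡ [ entry (a ∷ as) , δ ]′ y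
      split′ x (inj₁ (zero , j))  _  = lookup-++ˡ a free j
      split′ x (inj₁ (suc i , j)) eq = trans (lookup-++ʳ a free x) eq
      split′ x (inj₂ q)           eq = trans (lookup-++ʳ a free x) eq

      split : ∀ x → lookup (a ++ free) (boundIndex k (s x) x) ≡
                    lookup (tabulate ([ entry (a ∷ as) , δ ]′ ∘ s)) x
      split x = trans (split′ x (s x) (lookup∘tabulate _ x)) (sym (lookup∘tabulate _ x))

  -- With the elements of N as their own parameters under `id`, formulas can be combined without
  -- merging parameter tuples.
  definable⇒Holds : {X : Pred (Vec (Carrier N) m) ℓ} → Definable N X →
                    Σ[ S ∈ FormulaOver L (Fin m) (Carrier N) ] (∀ a → X a ⇔ Holds N S (lookup a) id)
  definable⇒Holds {m = m} (k , φ , c , X⇔φ) =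
    φ at ([ inj₁ , inj₂ ∘ lookup c ]′ ∘ splitAt m) , λ a → ⇔-trans (X⇔φ a)
      (≡⇒ (cong (Satisfies N φ) (lookup-extensionality (λ x →
        trans (lookup-splitAt m a c x)
          (trans (value a (splitAt m x)) (sym (lookup∘tabulate _ x)))))))
    where
    value : ∀ a y → [ lookup a , lookup c ]′ y ≡ [ lookup a , id ]′ ([ inj₁ , inj₂ ∘ lookup c ]′ y)
    value a (inj₁ _) = refl
    value a (inj₂ _) = refl

  Holds⇒definable : (S : FormulaOver L (Fin m) P) (δ : P → Carrier N) →
                    Definable N (λ a → Holds N S (lookup a) δ)
  Holds⇒definable {m = m} (_at_ {k} φ s) δ =
    k , rename (λ x → index (s x) x) φ , c , λ a → ⇔-sym (satisfies-rename N _ φ (λ x →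
      trans (value a x (s x) (lookup∘tabulate _ x)) (sym (lookup∘tabulate _ x))))
    where
    index : Fin m ⊎ _ → Fin k → Fin (m + k)
    index (inj₁ i) _ = i ↑ˡ k
    index (inj₂ _) x = m ↑ʳ x

    -- One parameter per position of φ; positions filled by a variable get a default that the
    -- renamed formula never reads.
    c = tabulate ([ const (nonempty N) , δ ]′ ∘ s)

    value : ∀ a x y → lookup c x ≡ [ const (nonempty N) , δ ]′ y →
            lookup (a ++ c) (index y x) ≡ [ lookup a , δ ]′ y
    value a x (inj₁ i) _  = lookup-++ˡ a c i
    value a x (inj₂ _) eq = trans (lookup-++ʳ a c x) eq

-- Selection of coordinates.

select : (Fin m → Fin n) → Vec A n → Vec A m
select h xs = tabulate (lookup xs ∘ h)

map-select : (f : A → B) (h : Fin m → Fin n) (xs : Vec A n) →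
             map f (select h xs) ≡ select h (map f xs)
map-select f h xs = lookup-extensionality (λ i →
  trans (lookup-map i f (select h xs)) (trans (cong f (lookup∘tabulate _ i))
    (trans (sym (lookup-map (h i) f xs)) (sym (lookup∘tabulate _ i)))))

select-↑ʳ : (xs : Vec A m) (ys : Vec A n) → select (m ↑ʳ_) (xs ++ ys) ≡ ys
select-↑ʳ xs ys = lookup-extensionality (λ i → trans (lookup∘tabulate _ i) (lookup-++ʳ xs ys i))

select-↑ˡ : (xs : Vec A m) (ys : Vec A n) → select (_↑ˡ n) (xs ++ ys) ≡ xs
select-↑ˡ xs ys = lookup-extensionality (λ i → trans (lookup∘tabulate _ i) (lookup-++ˡ xs ys i))

select-∘ : (g : Fin j → Fin m) (h : Fin m → Fin n) (xs : Vec A n) →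
           select (h ∘ g) xs ≡ select g (select h xs)
select-∘ g h xs = tabulate-cong (λ i → sym (lookup∘tabulate _ (g i)))

-- Translation of formulas along an interpretation.

module Translation {L L′ : Language ℓ} (excluded-middle : ExcludedMiddle ℓ)
                   {N : Structure L} {M : Structure L′} (I : Interpretation N M) where

  open Interpretation I renaming (to to decode)

  -- Extending `decode` by a default makes the image of a vector of tuples a plain `map`; the
  -- default is harmless because correctness is claimed only on `Domain`.
  value : Vec (Carrier N) dim → Carrier M
  value a with excluded-middle {Domain a}
  ... | yes a∈D = decode a a∈D
  ... | no  _   = nonempty M

  value-decode : ∀ a (a∈D : Domain a) → value a ≡ decode a a∈D
  value-decode a a∈D with excluded-middle {Domain a}
  ... | yes _   = refl
  ... | no  a∉D = contradiction a∈D a∉D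

  reduce-decode : {as : Vec (Vec (Carrier N) dim) m} (as∈D : All Domain as) →
                  reduce (λ {a} a∈D → decode a a∈D) as∈D ≡ map value as
  reduce-decode []           = refl
  reduce-decode (a∈D ∷ as∈D) = cong₂ _∷_ (sym (value-decode _ a∈D)) (reduce-decode as∈D)

  -- This section of `value` supplies the trace embedding.
  code : Carrier M → Vec (Carrier N) dim
  code b = proj₁ (surjective b)

  code∈Domain : ∀ b → Domain (code b)
  code∈Domain b = proj₁ (proj₂ (surjective b))

  value-code : ∀ b → value (code b) ≡ b
  value-code b = trans (value-decode _ (code∈Domain b)) (proj₂ (proj₂ (surjective b)))

  -- Correctness is demanded for all codes of the elements, not only those chosen by `code`, because
  -- a quantifier in N may return any tuple of the domain as its witness.
  record Translatable (X : Pred (Vec (Carrier M) m) ℓ) : Set ℓ where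
    constructor _,_
    field
      translation : FormulaOver L (Fin m × Fin dim) (Carrier N)
      correct     : ∀ as → All Domain as → X (map value as) ⇔ Holds N translation (entry as) id

  open Translatable

  translatable-⇔ : {X Y : Pred (Vec (Carrier M) m) ℓ} → (∀ b → X b ⇔ Y b) → Translatable X → Translatable Y
  translatable-⇔ X⇔Y (S , eq) = S , λ as as∈D → ⇔-trans (⇔-sym (X⇔Y _)) (eq as as∈D)

  -- The membership part of `Pullback` is supplied by the assumption on `as`, and `remQuot` turns
  -- the flat variables of `concat` into pairs.
  translatable-pullback : {X : Pred (Vec (Carrier M) m) ℓ} → PullbackDefinable X → Translatable X
  translatable-pullback {m} {X} (Y , Y-def , X⇔Y) =
    let S , Y⇔S = definable⇒Holds N Y-def in
    substitute (map₁ (remQuot dim)) S , λ as as∈D →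
      ⇔-trans (mk⇔ (λ x → as∈D , subst X (sym (reduce-decode as∈D)) x)
                   (λ (as∈D′ , x) → subst X (reduce-decode as∈D′) x))
      (⇔-trans (X⇔Y as)
      (⇔-trans (Y⇔S (concat as))
      (⇔-sym (Holds-substitute N (map₁ (remQuot {m} dim)) S {lookup (concat as)} {id} {entry as} {id} (λ
        { (inj₁ x) → trans (sym (lookup-concat as _ _)) (cong (lookup (concat as)) (combine-remQuot {m} dim x))
        ; (inj₂ _) → refl })))))

  translatable-select : (h : Fin m → Fin n) {X : Pred (Vec (Carrier M) m) ℓ} →
                        Translatable X → Translatable (X ∘ select h)
  translatable-select h {X} (S , X⇔S) = substitute (map₁ (λ (i , j) → h i , j)) S , λ as as∈D →
    ⇔-trans (≡⇒ (cong X (sym (map-select value h as))))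
    (⇔-trans (X⇔S _ (Allₚ.tabulate⁺ (λ i → Allₚ.lookup⁺ as∈D (h i))))
    (⇔-sym (Holds-substitute N (map₁ (λ (i , j) → h i , j)) S (λ
      { (inj₁ (i , j)) → cong (λ a → lookup a j) (sym (lookup∘tabulate _ i))
      ; (inj₂ _) → refl }))))

  translatable-not : {X : Pred (Vec (Carrier M) m) ℓ} → Translatable X → Translatable (λ b → ¬ X b)
  translatable-not (S , X⇔S) = negation S , λ as as∈D → ¬-cong-⇔ (X⇔S as as∈D)

  translatable-and : {X Y : Pred (Vec (Carrier M) m) ℓ} → Translatable X → Translatable Y →
                     Translatable (λ b → X b × Y b)
  translatable-and (S , X⇔S) (T , Y⇔T) = conjunction S T , λ as as∈D →
    ⇔-trans (X⇔S as as∈D ×-⇔ Y⇔T as as∈D) (⇔-sym (Holds-conjunction N S T))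

  -- The quantifier over M becomes a block of quantifiers relativised to `Domain`: a witness b
  -- yields the tuple `code b`, and a witness tuple a yields `value a`.
  translatable-exists : {X : Pred (Vec (Carrier M) (suc m)) ℓ} → Translatable X →
                        Translatable (λ b → ∃[ a ] X (a ∷ b))
  translatable-exists {X = X} (S , X⇔S) =
    existsBlock (nonempty N) (conjunction inDomain S) , λ as as∈D →
      ⇔-trans (mk⇔
        (λ (b , x) → code b , from (Holds-conjunction N inDomain S)
          (to inDomain-correct (code∈Domain b) ,
           to (X⇔S (code b ∷ as) (code∈Domain b ∷ as∈D)) (subst (λ c → X (c ∷ _)) (sym (value-code b)) x)))
        (λ (a , p) → let p₁ , p₂ = to (Holds-conjunction N inDomain S) p in
          value a , from (X⇔S (a ∷ as) (from inDomain-correct p₁ ∷ as∈D)) p₂))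
      (⇔-sym (Holds-existsBlock N (nonempty N) (conjunction inDomain S)))
    where
    D = definable⇒Holds N domain-definable
    inDomain = substitute (map₁ (zero ,_)) (proj₁ D)

    inDomain-correct : ∀ {a as} → Domain a ⇔ Holds N inDomain (entry (a ∷ as)) id
    inDomain-correct {a} = ⇔-trans (proj₂ D a)
      (⇔-sym (Holds-substitute N (map₁ (zero ,_)) (proj₁ D) (λ { (inj₁ _) → refl ; (inj₂ _) → refl })))

  mutual
    -- An interpretation pulls back only graphs of basic functions, so terms are unnested by naming
    -- the value of each one with a variable y. The map u locates the variables of t, which shift as
    -- new values are put in front.
    translatable-term : (t : Term L′ k) (u : Fin k → Fin m) (y : Fin m) →
                        Translatable (λ b → ⟦_⟧ M t (select u b) ≡ lookup b y)
    translatable-term (var x) u y =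
      translatable-⇔ (λ b → ≡⇒ (cong (_≡ lookup b y) (sym (lookup∘tabulate _ x))))
        (translatable-select (λ { zero → u x ; (suc _) → y })
          (translatable-pullback {X = Diagonal (Carrier M)} equality-definable))
    translatable-term {m = m} (app {r} f ts) u y =
      translatable-⇔ (λ b → ≡⇒ (cong₂ (λ c a → function M f c ≡ a)
                                   (select-↑ˡ (⟦_⟧* M ts (select u b)) b)
                                   (lookup-++ʳ (⟦_⟧* M ts (select u b)) b y)))
        (translatable-terms ts u
          -- The graph lists the value first: it is y, past the r arguments.
          (translatable-select {n = r + m} (λ { zero → r ↑ʳ y ; (suc x) → x ↑ˡ m })
            (translatable-pullback {X = Graph (function M f)} (function-definable f))))

    -- The values of `ts` are quantified one at a time. Absorbing the value of t into the predicate
    -- leaves one on the values of the remaining terms, to which recursion applies.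
    translatable-terms : (ts : Vec (Term L′ k) r) (u : Fin k → Fin m) {Z : Pred (Vec (Carrier M) (r + m)) ℓ} →
                         Translatable Z → Translatable (λ b → Z (⟦_⟧* M ts (select u b) ++ b))
    translatable-terms []                 u     Z-tr = Z-tr
    translatable-terms {r = suc r} (t ∷ ts) u {Z} Z-tr =
      translatable-⇔ (λ b → mk⇔
        (λ (a , eq , z) → subst (λ c → Z (c ∷ _)) (sym (trans (sym (t-value b a)) eq)) z)
        (λ z → let a = ⟦_⟧ M t (select u b) in a , t-value b a , z))
        (translatable-terms ts u
          (translatable-exists
            -- The shift passes the new value a by `suc` and the values of the remaining terms by
            -- `r ↑ʳ_`.
            (translatable-and (translatable-term t (suc ∘ (r ↑ʳ_) ∘ u) zero) Z-tr)))
      where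
      t-value : ∀ b a → ⟦_⟧ M t (select (suc ∘ (r ↑ʳ_) ∘ u) (a ∷ ⟦_⟧* M ts (select u b) ++ b))
                        ≡ ⟦_⟧ M t (select u b)
      t-value b a = cong (⟦_⟧ M t)
        (trans (select-∘ u (r ↑ʳ_) (⟦_⟧* M ts (select u b) ++ b))
               (cong (select u) (select-↑ʳ (⟦_⟧* M ts (select u b)) b)))

  translatable-satisfies : (φ : Formula L′ m) → Translatable (Satisfies M φ)
  -- Two terms are compared through a common value a, as `translatable-term` only equates a term
  -- with a variable.
  translatable-satisfies (equal s t) =
    translatable-⇔ (λ b → mk⇔
        (λ (a , s≡a , t≡a) → trans (weaken s b a) (trans s≡a (trans (sym t≡a) (sym (weaken t b a)))))
        (λ s≡t → let a = ⟦_⟧ M t b in a , trans (sym (weaken s b a)) s≡t , sym (weaken t b a)))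
      (translatable-exists (translatable-and (translatable-term s suc zero) (translatable-term t suc zero)))
    where
    weaken : ∀ t b a → ⟦_⟧ M t b ≡ ⟦_⟧ M t (select suc (a ∷ b))
    weaken t b a = cong (⟦_⟧ M t) (sym (tabulate∘lookup b))
  translatable-satisfies {m} (rel R ts) =
    translatable-⇔ (λ b → ≡⇒ (cong (relation M R)
        (trans (select-↑ˡ (⟦_⟧* M ts (select id b)) b) (cong (⟦_⟧* M ts) (tabulate∘lookup b)))))
      (translatable-terms ts id
        (translatable-select (_↑ˡ m) (translatable-pullback {X = relation M R} (relation-definable R))))
  translatable-satisfies (not φ)    = translatable-not (translatable-satisfies φ)
  translatable-satisfies (and φ ψ)  = translatable-and (translatable-satisfies φ) (translatable-satisfies ψ)
  translatable-satisfies (exists φ) = translatable-exists (translatable-satisfies φ)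

  translate : Formula L′ m → FormulaOver L (Fin m × Fin dim) (Carrier N)
  translate φ = translation (translatable-satisfies φ)

  translate-correct : (φ : Formula L′ m) (b : Vec (Carrier M) m) →
                      Satisfies M φ b ⇔ Holds N (translate φ) (entry (map code b)) id
  translate-correct φ b =
    ⇔-trans (≡⇒ (cong (Satisfies M φ)
        (sym (trans (sym (map-∘ value code b)) (trans (map-cong value-code b) (map-id b))))))
      (correct (translatable-satisfies φ) (map code b) (Allₚ.map⁺ (All.universal code∈Domain b)))

-- Trace definitions from translations.

traceDefines-translation :
  {L L′ : Language ℓ} (N : Structure L) (M : Structure L′) →
  1 ≤ d → (τ : Carrier M → Vec (Carrier N) d) (δ : P → Carrier N)
  (translate : ∀ {m} → Formula L′ m → FormulaOver L (Fin m × Fin d) P) →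
  (∀ {m} (φ : Formula L′ m) b → Satisfies M φ b ⇔ Holds N (translate φ) (entry (map τ b)) δ) →
  TraceDefines N M
traceDefines-translation {d = d} {P = P} {L} N M d≥1 τ δ translate correct =
  d , d≥1 , τ , λ m _ X (k , φ , c , X⇔φ) →
    -- All m + k variables are translated. Coordinates of the m arguments remain variables, while
    -- those of τ at the parameters c of X become parameters from N.
    let source : (Fin (m + k) × Fin d) ⊎ P → Fin (m * d) ⊎ Carrier N
        source = λ
          { (inj₁ (x , j)) → [ (λ i → inj₁ (combine i j)) , (λ i → inj₂ (lookup (τ (lookup c i)) j)) ]′ (splitAt m x)
          ; (inj₂ p)       → inj₂ (δ p) }
        S = substitute source (translate φ)
    in _ , Holds⇒definable N S id , λ a →
      ⇔-trans (X⇔φ a) (⇔-trans (correct φ (a ++ c))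
        (⇔-sym (Holds-substitute N source (translate φ) (λ
          { (inj₁ (x , j)) → trans (value a c j (splitAt m x))
              (sym (cong (λ b → lookup b j) (trans (lookup-map x τ (a ++ c)) (cong τ (lookup-splitAt m a c x)))))
          ; (inj₂ _) → refl }))))
  where
  value : ∀ {m k} (a : Vec (Carrier M) m) (c : Vec (Carrier M) k) j y →
          [ lookup (concat (map τ a)) , id ]′
            ([ (λ i → inj₁ (combine i j)) , (λ i → inj₂ (lookup (τ (lookup c i)) j)) ]′ y)
          ≡ lookup (τ ([ lookup a , lookup c ]′ y)) j
  value a c j (inj₁ i) = trans (lookup-concat (map τ a) i j) (cong (λ b → lookup b j) (lookup-map i τ a))
  value a c j (inj₂ i) = refl

traceDefines-interprets : {L L′ : Language ℓ} → ExcludedMiddle ℓ → (N : Structure L) (M : Structure L′) →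
                          Interprets N M → TraceDefines N M
traceDefines-interprets em N M I =
  traceDefines-translation N M dim≥1 code id translate translate-correct
  where
  open Interpretation I using (dim≥1)
  open Translation em I

-- Boolean subsets and Zorn's lemma.

-- Boolean-valued subsets are impredicative: under excluded middle every
-- predicate has one, while the powerset stays in the universe of A.
Subset : Set ℓ → Set ℓ
Subset A = A → Bool

infix 4 _∈_ _⊆_

_∈_ : A → Subset A → Set
x ∈ p = T (p x)

_⊆_ : Subset A → Subset A → Set _
p ⊆ q = ∀ {x} → x ∈ p → x ∈ q

module ClassicalSubsets (classical : Classical) where

  open Classical classical

  opaque
    comprehension : ∀ {a} → (A → Set a) → Subset A
    comprehension P x = isYes (excluded-middle {P = P x})

    ∈-comprehension : ∀ {a} {P : A → Set a} {x} → x ∈ comprehension P ⇔ P x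
    ∈-comprehension = mk⇔ toWitness fromWitness

  ⊆-antisym : {p q : Subset A} → p ⊆ q → q ⊆ p → p ≡ q
  ⊆-antisym p⊆q q⊆p = extensionality λ x →
    ⇔→≡ (⇔-trans (⇔-sym T-≡) (⇔-trans (mk⇔ p⊆q q⊆p) T-≡))

  ⋃ : Subset (Subset A) → Subset A
  ⋃ K = comprehension (λ x → ∃[ p ] p ∈ K × x ∈ p)

  ⊆-⋃ : {K : Subset (Subset A)} {p : Subset A} → p ∈ K → p ⊆ ⋃ K
  ⊆-⋃ p∈K x∈p = from ∈-comprehension (_ , p∈K , x∈p)

  insert : A → Subset A → Subset A
  insert x p = comprehension (λ y → y ≡ x ⊎ y ∈ p)

  Chain : Subset (Subset A) → Set _
  Chain K = ∀ {p q} → p ∈ K → q ∈ K → p ⊆ q ⊎ q ⊆ p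

  module Zorn {A : Set ℓ} (C : Subset A → Set ℓ) where

    Extension : Subset A → Set ℓ
    Extension p = ∃[ x ] ¬ x ∈ p × C (insert x p)

    grow : Subset A → Subset A
    grow p with excluded-middle {P = Extension p}
    ... | yes (x , _) = insert x p
    ... | no  _       = p

    ⊆-grow : ∀ p → p ⊆ grow p
    ⊆-grow p y∈p with excluded-middle {P = Extension p}
    ... | yes _ = from ∈-comprehension (inj₂ y∈p)
    ... | no  _ = y∈p

    grow-preserves : ∀ p → C p → C (grow p)
    grow-preserves p Cp with excluded-middle {P = Extension p}
    ... | yes (_ , _ , C-insert) = C-insert
    ... | no  _                  = Cp

    -- If p had an extension, `grow` would add an element outside p, against the inclusion.
    grow-⊆⇒maximal : ∀ p → grow p ⊆ p → ∀ x → C (insert x p) → x ∈ p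
    grow-⊆⇒maximal p grow⊆p x C-insert with excluded-middle {P = Extension p}
    ... | yes (y , y∉p , _) = contradiction (grow⊆p (from ∈-comprehension (inj₁ refl))) y∉p
    ... | no  maximal       = decidable-stable excluded-middle (λ x∉p → maximal (x , x∉p , C-insert))

    -- The Bourbaki–Witt argument: all elements of the tower are extreme, so the
    -- tower is a chain and its union is fixed by grow.
    data Tower : Subset A → Set ℓ where
      grow-tower : ∀ {p} → Tower p → Tower (grow p)
      ⋃-tower    : ∀ K → (∀ {p} → p ∈ K → Tower p) → Tower (⋃ K)

    Extreme : Subset A → Set ℓ
    Extreme p = ∀ {q} → Tower q → q ⊆ p → q ≡ p ⊎ grow q ⊆ p

    -- Induction on the tower. At `grow q` with q inside p, extremeness of p decides; at a union,
    -- either some member contains `grow p` or all members lie inside p.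
    extreme-comparable : ∀ {p q} → Extreme p → Tower q → q ⊆ p ⊎ grow p ⊆ q
    extreme-comparable p-ext (grow-tower {q} tq) with extreme-comparable p-ext tq
    ... | inj₂ grow-p⊆q = inj₂ (⊆-grow q ∘ grow-p⊆q)
    ... | inj₁ q⊆p with p-ext tq q⊆p
    ...   | inj₁ refl     = inj₂ id
    ...   | inj₂ grow-q⊆p = inj₁ grow-q⊆p
    extreme-comparable {p} p-ext (⋃-tower K t)
      with excluded-middle {P = ∃[ q ] q ∈ K × grow p ⊆ q}
    ... | yes (q , q∈K , grow-p⊆q) = inj₂ (⊆-⋃ q∈K ∘ grow-p⊆q)
    ... | no  none = inj₁ (λ x∈⋃K →
      let q , q∈K , x∈q = to ∈-comprehension x∈⋃K in
      [ (λ q⊆p → q⊆p x∈q) , (λ grow-p⊆q → contradiction (q , q∈K , λ {x} → grow-p⊆q {x}) none) ]′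
        (extreme-comparable p-ext (t q∈K)))

    -- Induction on the tower. Below a union, either q contains every member and equals the union,
    -- or some member p is not inside q; comparing q with this p, extreme by induction, gives
    -- `grow q ⊆ p`.
    tower-extreme : ∀ {p} → Tower p → Extreme p
    tower-extreme (grow-tower {p} tp) tq q⊆grow-p with extreme-comparable (tower-extreme tp) tq
    ... | inj₂ grow-p⊆q = inj₁ (⊆-antisym q⊆grow-p grow-p⊆q)
    ... | inj₁ q⊆p with tower-extreme tp tq q⊆p
    ...   | inj₁ refl     = inj₂ id
    ...   | inj₂ grow-q⊆p = inj₂ (⊆-grow p ∘ grow-q⊆p)
    tower-extreme (⋃-tower K t) {q} tq q⊆⋃K
      with excluded-middle {P = ∃[ p ] p ∈ K × ¬ (p ⊆ q)}
    ... | no none = inj₁ (⊆-antisym q⊆⋃K (λ x∈⋃K →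
      let p , p∈K , x∈p = to ∈-comprehension x∈⋃K in
      decidable-stable excluded-middle (λ x∉q → none (p , p∈K , λ p⊆q → x∉q (p⊆q x∈p)))))
    ... | yes (p , p∈K , p⊈q) with extreme-comparable (tower-extreme (t p∈K)) tq
    ...   | inj₂ grow-p⊆q = contradiction (λ {x} → grow-p⊆q {x} ∘ ⊆-grow p) p⊈q
    ...   | inj₁ q⊆p with tower-extreme (t p∈K) tq q⊆p
    ...     | inj₁ refl     = contradiction (λ {x} → id) p⊈q
    ...     | inj₂ grow-q⊆p = inj₂ (⊆-⋃ p∈K ∘ grow-q⊆p)

    tower-chain : ∀ {p q} → Tower p → Tower q → p ⊆ q ⊎ q ⊆ p
    tower-chain {p} {q} tp tq with extreme-comparable (tower-extreme tq) tp
    ... | inj₁ p⊆q      = inj₁ p⊆q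
    ... | inj₂ grow-q⊆p = inj₂ (grow-q⊆p ∘ ⊆-grow q)

    module _ (⋃-preserves : ∀ K → Chain K → (∀ {p} → p ∈ K → C p) → C (⋃ K)) where

      tower⇒C : ∀ {p} → Tower p → C p
      tower⇒C (grow-tower tp) = grow-preserves _ (tower⇒C tp)
      tower⇒C (⋃-tower K t)   =
        ⋃-preserves K (λ p∈K q∈K → tower-chain (t p∈K) (t q∈K)) (λ p∈K → tower⇒C (t p∈K))

      -- The union of the whole tower belongs to the tower, hence so does its image under `grow`,
      -- which is therefore contained in it. The empty chain starts the tower.
      zorn : ∃[ p ] C p × (∀ x → C (insert x p) → x ∈ p)
      zorn = top , tower⇒C top-tower , grow-⊆⇒maximal top
               (⊆-⋃ (from ∈-comprehension (grow-tower top-tower)))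
        where
        top = ⋃ (comprehension Tower)
        top-tower : Tower top
        top-tower = ⋃-tower (comprehension Tower) (to ∈-comprehension)

-- Ultrafilters and their construction from a filter base.

record Ultrafilter (I : Set ℓ) : Set (Level.suc ℓ) where
  field
    Large        : Pred I ℓ → Set ℓ
    large-∀      : ∀ {X} → (∀ i → X i) → Large X
    large-map    : ∀ {X Y} → (∀ i → X i → Y i) → Large X → Large Y
    large-zip    : ∀ {X Y} → Large X → Large Y → Large (λ i → X i × Y i)
    large-proper : ∀ {X} → Large X → Large (λ i → ¬ X i) → ⊥
    large-ultra  : ∀ {X} → ¬ Large X → Large (λ i → ¬ X i)

  large-⇔ : ∀ {X Y} → (∀ i → X i ⇔ Y i) → Large X ⇔ Large Y
  large-⇔ X⇔Y = mk⇔ (large-map (λ i → to (X⇔Y i))) (large-map (λ i → from (X⇔Y i)))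

  large-map₂ : ∀ {X Y Z} → (∀ i → X i → Y i → Z i) → Large X → Large Y → Large Z
  large-map₂ f X Y = large-map (λ i (x , y) → f i x y) (large-zip X Y)

  large-¬ : ∀ {X} → (¬ Large X) ⇔ Large (λ i → ¬ X i)
  large-¬ = mk⇔ large-ultra (λ ¬X X → large-proper X ¬X)

  large-× : ∀ {X Y} → (Large X × Large Y) ⇔ Large (λ i → X i × Y i)
  large-× = mk⇔ (uncurry large-zip) (λ XY → large-map (λ _ → proj₁) XY , large-map (λ _ → proj₂) XY)

-- The sets β b form a base of a proper filter; a maximal family compatible with them is an
-- ultrafilter containing them.
module UltrafilterExtension (classical : Classical) {I B : Set ℓ} (β : B → Pred I ℓ)
  (b₀ : B) (directed : ∀ b c → ∃[ e ] (∀ i → β e i → β b i × β c i)) (inhabited : ∀ b → ∃[ i ] β b i)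
  where

  open Classical classical
  open ClassicalSubsets classical

  AllIn : Subset (Subset I) → List (Subset I) → Set ℓ
  AllIn p = ListAll.All (_∈ p)

  InAll : I → List (Subset I) → Set ℓ
  InAll i = ListAll.All (i ∈_)

  -- The finite intersection property of p together with the base; by directedness one base set at a
  -- time is enough.
  Compatible : Subset (Subset I) → Set ℓ
  Compatible p = ∀ b xs → AllIn p xs → ∃[ i ] β b i × InAll i xs

  -- Of the finitely many members of K involved, the chain has a largest. The empty list is a
  -- separate case because K may be empty.
  finite-⋃ : ∀ {K} → Chain K → ∀ {xs} → AllIn (⋃ K) xs → xs ≡ List.[] ⊎ ∃[ p ] p ∈ K × AllIn p xs
  finite-⋃ chain [] = inj₁ refl
  finite-⋃ chain (x∈⋃ ∷ xs∈⋃) with to ∈-comprehension x∈⋃ | finite-⋃ chain xs∈⋃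
  ... | p , p∈K , x∈p | inj₁ refl = inj₂ (p , p∈K , x∈p ∷ [])
  ... | p , p∈K , x∈p | inj₂ (q , q∈K , xs∈q) with chain p∈K q∈K
  ...   | inj₁ p⊆q = inj₂ (q , q∈K , p⊆q x∈p ∷ xs∈q)
  ...   | inj₂ q⊆p = inj₂ (p , p∈K , x∈p ∷ ListAll.map q⊆p xs∈q)

  compatible-⋃ : ∀ K → Chain K → (∀ {p} → p ∈ K → Compatible p) → Compatible (⋃ K)
  compatible-⋃ K chain compatible b xs xs∈⋃ with finite-⋃ chain xs∈⋃
  ... | inj₁ refl             = map₂ (_, []) (inhabited b)
  ... | inj₂ (p , p∈K , xs∈p) = compatible p∈K b xs xs∈p

  maximal : ∃[ p ] Compatible p × (∀ x → Compatible (insert x p) → x ∈ p)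
  maximal = Zorn.zorn Compatible compatible-⋃

  E : Subset (Subset I)
  E = proj₁ maximal

  without : ∀ {x xs} → AllIn (insert x E) xs →
            ∃[ ys ] AllIn E ys × (∀ i → i ∈ x → InAll i ys → InAll i xs)
  without [] = List.[] , [] , λ _ _ _ → []
  without {xs = z List.∷ _} (z∈ ∷ zs∈) with to ∈-comprehension z∈ | without zs∈
  ... | inj₁ refl | ys , ys∈E , f = ys , ys∈E , λ i i∈x i∈ys → i∈x ∷ f i i∈x i∈ys
  ... | inj₂ z∈E  | ys , ys∈E , f =
    z List.∷ ys , z∈E ∷ ys∈E , λ { i i∈x (i∈z ∷ i∈ys) → i∈z ∷ f i i∈x i∈ys }

  -- By maximality, adding x to E destroys compatibility. Once x is dropped from the failing list, a
  -- base set and finitely many members of E remain whose intersection misses x.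
  refute : ∀ {x} → ¬ x ∈ E → ∃[ b ] ∃[ ys ] AllIn E ys × (∀ i → β b i → InAll i ys → ¬ i ∈ x)
  refute {x} x∉E = decidable-stable excluded-middle λ irrefutable →
    x∉E (proj₂ (proj₂ maximal) x λ b xs xs∈ →
      let ys , ys∈E , f = without xs∈ in
      decidable-stable excluded-middle λ none →
        irrefutable (b , ys , ys∈E , λ i i∈b i∈ys i∈x → none (i , i∈b , f i i∈x i∈ys)))

  -- Otherwise `refute` gives a second base set and list missing x; compatibility, at a base set
  -- inside both, yields a point common to both lists, which is then in x and not in x. The filter
  -- laws are instances.
  deduce : ∀ {x} b ys → AllIn E ys → (∀ i → β b i → InAll i ys → i ∈ x) → x ∈ E
  deduce b ys ys∈E f = decidable-stable excluded-middle λ x∉E →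
    let c , zs , zs∈E , g = refute x∉E
        e , e⊆            = directed b c
        i , i∈e , i∈yszs  = proj₁ (proj₂ maximal) e (ys List.++ zs) (ListAllₚ.++⁺ ys∈E zs∈E)
        i∈ys , i∈zs       = ListAllₚ.++⁻ ys i∈yszs
        i∈b , i∈c         = e⊆ i i∈e
    in g i i∈c i∈zs (f i i∈b i∈ys)

  extend : Ultrafilter I
  extend = record
    { Large        = λ X → Lift ℓ (comprehension X ∈ E)
    ; large-∀      = λ X → lift (deduce b₀ List.[] [] (λ i _ _ → from ∈-comprehension (X i)))
    ; large-map    = λ { f (lift X) → lift (deduce b₀ (_ List.∷ List.[]) (X ∷ [])
                       (λ { i _ (x ∷ []) → from ∈-comprehension (f i (to ∈-comprehension x)) })) }
    ; large-zip    = λ { (lift X) (lift Y) → lift (deduce b₀ (_ List.∷ _ List.∷ List.[]) (X ∷ Y ∷ [])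
                       (λ { i _ (x ∷ y ∷ []) → from ∈-comprehension (to ∈-comprehension x , to ∈-comprehension y) })) }
    ; large-proper = λ { (lift X) (lift ¬X) → disjoint
                       (proj₁ (proj₂ maximal) b₀ (_ List.∷ _ List.∷ List.[]) (X ∷ ¬X ∷ [])) }
    ; large-ultra  = λ ¬X → let b , ys , ys∈E , f = refute (¬X ∘ lift) in
                       lift (deduce b ys ys∈E (λ i i∈b i∈ys →
                         from ∈-comprehension (λ x → f i i∈b i∈ys (from ∈-comprehension x))))
    }
    where
    disjoint : ∀ {X b} → ∃[ i ] β b i × InAll i (comprehension X List.∷ comprehension (λ i → ¬ X i) List.∷ List.[]) → ⊥
    disjoint (i , _ , x ∷ ¬x ∷ []) = to ∈-comprehension ¬x (to ∈-comprehension x)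

  base-large : ∀ b → Ultrafilter.Large extend (β b)
  base-large b = lift (deduce b List.[] [] (λ i i∈b _ → from ∈-comprehension i∈b))

-- Ultrapowers and Łoś's theorem.

module UltrapowerOf (classical : Classical) {I : Set ℓ} (U : Ultrafilter I)
                    {L : Language ℓ} (N : Structure L) where

  open Classical classical
  open ClassicalSubsets classical
  open Ultrafilter U

  infix 4 _≈_

  _≈_ : (I → Carrier N) → (I → Carrier N) → Set ℓ
  f ≈ g = Large (λ i → f i ≡ g i)

  -- The choice depends on the subset alone: equivalent functions have equal classes by
  -- extensionality, hence the same representative.
  choose : Subset (I → Carrier N) → I → Carrier N
  choose p with excluded-middle {P = ∃[ f ] f ∈ p}
  ... | yes (f , _) = f
  ... | no  _       = const (nonempty N)

  choose-∈ : ∀ {p f} → f ∈ p → choose p ∈ p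
  choose-∈ {p} {f} f∈p with excluded-middle {P = ∃[ f ] f ∈ p}
  ... | yes (_ , g∈p) = g∈p
  ... | no  empty     = contradiction (f , f∈p) empty

  canonical : (I → Carrier N) → I → Carrier N
  canonical f = choose (comprehension (f ≈_))

  canonical-≈ : ∀ f → canonical f ≈ f
  canonical-≈ f = large-map (λ _ → sym)
    (to ∈-comprehension (choose-∈ {comprehension (f ≈_)} {f}
      (from ∈-comprehension (large-∀ {λ i → f i ≡ f i} (λ _ → refl)))))

  ≈⇒canonical-≡ : ∀ {f g} → f ≈ g → canonical f ≡ canonical g
  ≈⇒canonical-≡ f≈g = cong choose (⊆-antisym
    (λ h∈ → from ∈-comprehension (large-map₂ (λ _ p q → trans (sym p) q) f≈g (to ∈-comprehension h∈)))
    (λ h∈ → from ∈-comprehension (large-map₂ (λ _ → trans) f≈g (to ∈-comprehension h∈))))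

  -- The quotient by ≈, as the set of chosen representatives.
  record Element : Set ℓ where
    constructor element
    field
      at           : I → Carrier N
      .isCanonical : canonical at ≡ at

  open Element

  at-injective : ∀ {a b} → at a ≡ at b → a ≡ b
  at-injective refl = refl

  at-≈⇒≡ : ∀ {a b} → at a ≈ at b → a ≡ b
  at-≈⇒≡ {element f cf} {element g cg} f≈g = at-injective
    -- Deciding the equation turns the irrelevant proof of canonicity into a usable one.
    (trans (sym (recompute excluded-middle cf)) (trans (≈⇒canonical-≡ f≈g) (recompute excluded-middle cg)))

  ≡⇔at-≈ : ∀ {a b} → a ≡ b ⇔ at a ≈ at b
  ≡⇔at-≈ = mk⇔ (λ { refl → large-∀ (λ _ → refl) }) at-≈⇒≡

  [_] : (I → Carrier N) → Element
  [ f ] = element (canonical f) (≈⇒canonical-≡ (canonical-≈ f))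

  infixl 9 _!_

  _!_ : Vec Element k → I → Vec (Carrier N) k
  ρ ! i = map (λ a → at a i) ρ

  ultrapower : Structure L
  ultrapower = record
    { Carrier  = Element
    ; nonempty = [ const (nonempty N) ]
    ; function = λ f ρ → [ (λ i → function N f (ρ ! i)) ]
    ; relation = λ R ρ → Large (λ i → relation N R (ρ ! i))
    }

  mutual
    łoś-term : (t : Term L k) (ρ : Vec Element k) → at (⟦_⟧ ultrapower t ρ) ≈ (λ i → ⟦_⟧ N t (ρ ! i))
    łoś-term (var x)    ρ = large-∀ (λ i → sym (lookup-map x _ ρ))
    łoś-term (app f ts) ρ = large-map₂ (λ _ p q → trans p (cong (function N f) q))
      (canonical-≈ _) (łoś-terms ts ρ)

    łoś-terms : (ts : Vec (Term L k) r) (ρ : Vec Element k) →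
                Large (λ i → ⟦_⟧* ultrapower ts ρ ! i ≡ ⟦_⟧* N ts (ρ ! i))
    łoś-terms []       ρ = large-∀ (λ _ → refl)
    łoś-terms (t ∷ ts) ρ = large-map₂ (λ _ → cong₂ _∷_) (łoś-term t ρ) (łoś-terms ts ρ)

  łoś : (φ : Formula L k) (ρ : Vec Element k) →
        Satisfies ultrapower φ ρ ⇔ Large (λ i → Satisfies N φ (ρ ! i))
  łoś (equal s t) ρ = ⇔-trans ≡⇔at-≈ (mk⇔
    (λ s≈t → large-map₂ (λ _ p q → trans (sym p) q) (łoś-term s ρ)
               (large-map₂ (λ _ → trans) s≈t (łoś-term t ρ)))
    (λ s≈t → large-map₂ (λ _ → trans) (łoś-term s ρ)
               (large-map₂ (λ _ p q → trans p (sym q)) s≈t (łoś-term t ρ))))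
  łoś (rel R ts) ρ = mk⇔
    (large-map₂ (λ _ → subst (relation N R)) (łoś-terms ts ρ))
    (large-map₂ (λ _ → subst (relation N R) ∘ sym) (łoś-terms ts ρ))
  -- Here it matters that the complement of a set that is not large is large.
  łoś (not φ)   ρ = ⇔-trans (¬-cong-⇔ (łoś φ ρ)) large-¬
  łoś (and φ ψ) ρ = ⇔-trans (łoś φ ρ ×-⇔ łoś ψ ρ) large-×
  łoś (exists φ) ρ = mk⇔
    (λ (a , p) → large-map (λ i → at a i ,_) (to (łoś φ (a ∷ ρ)) p))
    -- A witness is taken in each coordinate that has one. Its representative agrees with it only on
    -- a large set, which is intersected with the given one.
    (λ large → [ witness ] , from (łoś φ ([ witness ] ∷ ρ))
      (large-map₂ (λ i eq (a , p) → subst (λ b → Satisfies N φ (b ∷ ρ ! i)) (sym eq) (witness-satisfies i (a , p)))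
        (canonical-≈ witness) large))
    where
    witness : I → Carrier N
    witness i with excluded-middle {P = ∃[ a ] Satisfies N φ (a ∷ ρ ! i)}
    ... | yes (a , _) = a
    ... | no  _       = nonempty N

    witness-satisfies : ∀ i → ∃[ a ] Satisfies N φ (a ∷ ρ ! i) → Satisfies N φ (witness i ∷ ρ ! i)
    witness-satisfies i e with excluded-middle {P = ∃[ a ] Satisfies N φ (a ∷ ρ ! i)}
    ... | yes (_ , p) = p
    ... | no  none    = contradiction e none

  ultrapower-model : {T : Theory L} → Model T N → Model T ultrapower
  ultrapower-model N⊨T σ σ∈T = from (łoś σ []) (large-∀ (λ _ → N⊨T σ σ∈T))

  -- Agreement holds on a large set for each of the k coordinates, and finitely many large sets have
  -- a large intersection.
  large-tabulate : (u : Fin k → Element) (w : I → Fin k → Carrier N) →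
                   (∀ x → at (u x) ≈ (λ i → w i x)) → Large (λ i → tabulate u ! i ≡ tabulate (w i))
  large-tabulate {zero}  u w u≈w = large-∀ (λ _ → refl)
  large-tabulate {suc k} u w u≈w =
    large-map₂ (λ _ → cong₂ _∷_) (u≈w zero) (large-tabulate (u ∘ suc) (λ i → w i ∘ suc) (u≈w ∘ suc))

  -- V and P may be infinite, but a formula reads only finitely many of their values. Agreement up
  -- to ≈ is assumed because canonical representatives give no more.
  łoś-Holds : (S : FormulaOver L V P) (ρ : V → Element) (δ : P → Element)
              (ρ′ : I → V → Carrier N) (δ′ : P → Carrier N) →
              (∀ v → at (ρ v) ≈ (λ i → ρ′ i v)) → (∀ p → at (δ p) ≈ const (δ′ p)) →
              Holds ultrapower S ρ δ ⇔ Large (λ i → Holds N S (ρ′ i) δ′)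
  łoś-Holds (φ at s) ρ δ ρ′ δ′ ρ≈ δ≈ = ⇔-trans (łoś φ _) (mk⇔
    (large-map₂ (λ _ → subst (Satisfies N φ)) coordinates)
    (large-map₂ (λ _ → subst (Satisfies N φ) ∘ sym) coordinates))
    where
    coordinates = large-tabulate _ (λ i → [ ρ′ i , δ′ ]′ ∘ s) (λ x → value (s x))
      where
      value : ∀ y → at ([ ρ , δ ]′ y) ≈ (λ i → [ ρ′ i , δ′ ]′ y)
      value (inj₁ v) = ρ≈ v
      value (inj₂ p) = δ≈ p

-- An ultrafilter of maps between elementarily equivalent structures.

module ElementaryEquivalence (classical : Classical) {L : Language ℓ} (M M′ : Structure L)
                             (M′≡M : ∀ σ → M′ ⊨ σ → M ⊨ σ) where

  open Classical classical

  -- Repeated entries of b are first merged, since distinct variables may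
  -- otherwise be given distinct values in M.
  realise : (φ : Formula L n) (b : Vec (Carrier M′) n) → Satisfies M′ φ b →
            Σ[ i ∈ (Carrier M′ → Carrier M) ] Satisfies M φ (map i b)
  realise {n} φ b M′⊨φ = assign v ,
    to (satisfies-rename M merge φ (λ x → trans (lookup-++ˡ v [] (index x))
      (trans (sym (assign-lookup v x)) (sym (lookup-map x (assign v) b))))) M⊨φ
    where
    Occurs : Carrier M′ → Set _
    Occurs a = ∃[ x ] lookup b x ≡ a

    index : Fin n → Fin n
    index x with excluded-middle {P = Occurs (lookup b x)}
    ... | yes (y , _) = y
    ... | no  _       = x

    lookup-index : ∀ x → lookup b (index x) ≡ lookup b x
    lookup-index x with excluded-middle {P = Occurs (lookup b x)}
    ... | yes (_ , eq) = eq
    ... | no  _        = refl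

    -- The decision is the one made by `index`, so the two agree on entries of b; other elements get
    -- a default.
    assign : Vec (Carrier M) n → Carrier M′ → Carrier M
    assign v a with excluded-middle {P = Occurs a}
    ... | yes (y , _) = lookup v y
    ... | no  _       = nonempty M

    assign-lookup : ∀ v x → assign v (lookup b x) ≡ lookup v (index x)
    assign-lookup v x with excluded-middle {P = Occurs (lookup b x)}
    ... | yes _  = refl
    ... | no  ¬o = contradiction (x , refl) ¬o

    merge : Fin n → Fin (n + 0)
    merge x = index x ↑ˡ 0

    -- In M′ the tuple b witnesses the existential closure of the merged formula; this sentence
    -- passes to M, which returns new values v.
    realised : ∃[ v ] Satisfies M (rename merge φ) (v ++ [])
    realised = to (satisfies-exists^ M n (rename merge φ)) (M′≡M (exists^ n (rename merge φ))
      (from (satisfies-exists^ M′ n (rename merge φ)) (b ,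
        from (satisfies-rename M′ merge φ (λ x → trans (lookup-++ˡ b [] (index x)) (lookup-index x))) M′⊨φ)))

    v = proj₁ realised
    M⊨φ = proj₂ realised

  -- The elementary diagram of M′, which indexes the filter base.
  Diagram : Set _
  Diagram = ∃[ n ] Σ[ φ ∈ Formula L n ] Σ[ b ∈ Vec (Carrier M′) n ] Satisfies M′ φ b

  preserving : Diagram → Pred (Carrier M′ → Carrier M) _
  preserving (_ , φ , b , _) i = Satisfies M φ (map i b)

  private
    module Extension = UltrafilterExtension classical preserving
      (0 , exists (equal (var zero) (var zero)) , [] , nonempty M′ , refl)
      -- Directedness: two members of the diagram are bounded by their conjunction in disjoint
      -- variables.
      (λ (m , φ , b , M′⊨φ) (n , ψ , c , M′⊨ψ) →
        (m + n , and (rename (_↑ˡ n) φ) (rename (m ↑ʳ_) ψ) , b ++ c ,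
          from (satisfies-rename M′ _ φ (lookup-++ˡ b c)) M′⊨φ ,
          from (satisfies-rename M′ _ ψ (lookup-++ʳ b c)) M′⊨ψ) ,
        λ i (p , q) →
          to (satisfies-rename M (_↑ˡ n) φ (λ x → trans (lookup-map (x ↑ˡ n) i (b ++ c))
            (trans (cong i (lookup-++ˡ b c x)) (sym (lookup-map x i b))))) p ,
          to (satisfies-rename M (m ↑ʳ_) ψ (λ x → trans (lookup-map (m ↑ʳ x) i (b ++ c))
            (trans (cong i (lookup-++ʳ b c x)) (sym (lookup-map x i c))))) q)
      (λ (_ , φ , b , M′⊨φ) → realise φ b M′⊨φ)

  ultrafilter : Ultrafilter (Carrier M′ → Carrier M)
  ultrafilter = Extension.extend

  open Ultrafilter ultrafilter

  -- If φ fails at b, its negation is in the diagram, and the complementary set is the large one.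
  satisfies⇔large : (φ : Formula L n) (b : Vec (Carrier M′) n) →
                    Satisfies M′ φ b ⇔ Large (λ i → Satisfies M φ (map i b))
  satisfies⇔large φ b = mk⇔ (λ p → Extension.base-large (_ , φ , b , p))
    (λ large → decidable-stable excluded-middle
      (λ ¬p → large-proper large (Extension.base-large (_ , not φ , b , ¬p))))

-- Trace definitions between theories.

module _ (classical : Classical) where

  open Classical classical

  theoryTraceDefines-interprets : {L L′ : Language ℓ} {T : Theory L} {T′ : Theory L′} →
                                  Complete T′ → TheoryInterprets T T′ → TheoryTraceDefines T T′
  theoryTraceDefines-interprets {L′ = L′} {T′ = T′} complete (N , N⊨T , M , M⊨T′ , I) M′ M′⊨T′ =
    ultrapower , ultrapower-model N⊨T ,
    traceDefines-translation ultrapower M′ dim≥1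
      -- The parameters of the translation lie in N and enter the ultrapower as classes of constant
      -- functions.
      τ ([_] ∘ const) translate λ φ b →
        ⇔-trans (satisfies⇔large φ b)
        (⇔-trans (large-⇔ (λ i → translate-correct φ (map i b)))
        (⇔-sym (łoś-Holds (translate φ) (entry (map τ b)) ([_] ∘ const)
          (λ i → entry (map code (map i b))) id (τ-entry b) (λ p → canonical-≈ (const p)))))
    where
    -- Since M′ is a model of T′ satisfying σ, completeness can only make T′ entail σ itself.
    elementary : ∀ σ → M′ ⊨ σ → M ⊨ σ
    elementary σ M′⊨σ with complete σ
    ... | inj₁ T′⊢σ  = T′⊢σ M M⊨T′
    ... | inj₂ T′⊢¬σ = contradiction M′⊨σ (T′⊢¬σ M′ M′⊨T′)

    open Interpretation I using (dim; dim≥1)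
    open Translation excluded-middle I
    open ElementaryEquivalence classical M M′ elementary
    open Ultrafilter ultrafilter
    open UltrapowerOf classical ultrafilter N

    τ : Carrier M′ → Vec Element dim
    τ a = tabulate (λ j → [ (λ i → lookup (code (i a)) j) ])

    τ-entry : ∀ {m} (b : Vec (Carrier M′) m) x →
              Element.at (entry (map τ b) x) ≈ (λ i → entry (map code (map i b)) x)
    τ-entry b (x , j) = large-map₂ (λ i p q → trans p (trans q (sym (cong (λ a → lookup a j)
        (trans (lookup-map x code (map i b)) (cong code (lookup-map x i b)))))))
      (large-∀ (λ i → cong (λ a → Element.at a i)
        (trans (cong (λ a → lookup a j) (lookup-map x τ b)) (lookup∘tabulate _ j))))
      (canonical-≈ _)

  Th-complete : {L : Language ℓ} (M : Structure L) → Complete (Th M)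
  Th-complete M σ with excluded-middle {P = M ⊨ σ}
  ... | yes M⊨σ = inj₁ (λ M′ M′⊨Th → M′⊨Th σ M⊨σ)
  ... | no  M⊭σ = inj₂ (λ M′ M′⊨Th → M′⊨Th (not σ) M⊭σ)

  Th-interprets : {L L′ : Language ℓ} {N : Structure L} {M : Structure L′} →
                  Interprets N M → TheoryInterprets (Th N) (Th M)
  Th-interprets {N = N} {M} I = N , (λ _ p → p) , M , (λ _ p → p) , I

proposition1p4 : Classical → ∀ {ℓ} (L L′ : Language ℓ) →
    ((N : Structure L) (M : Structure L′) → Interprets N M → TraceDefines N M)
    × ((T : Theory L) (T′ : Theory L′) →
    Consistent T → Complete T → Consistent T′ → Complete T′ →
    TheoryInterprets T T′ → TheoryTraceDefines T T′)
    × ((M : Structure L) (N : Structure L′) →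
    MutuallyInterpretable M N → TraceEquivalent M N)
    × ((T : Theory L) (T′ : Theory L′) →
    Consistent T → Complete T → Consistent T′ → Complete T′ →
    TheoriesMutuallyInterpretable T T′ → TheoriesTraceEquivalent T T′)
proposition1p4 classical L L′ =
  traceDefines-interprets (Classical.excluded-middle classical) ,
  (λ T T′ _ _ _ complete′ → theoryTraceDefines-interprets classical complete′) ,
  -- The theory of a structure is complete, so the case of theories applies to `Th M` and `Th N`.
  (λ M N (I , J) →
    theoryTraceDefines-interprets classical (Th-complete classical N) (Th-interprets classical I) ,
    theoryTraceDefines-interprets classical (Th-complete classical M) (Th-interprets classical J)) ,
  (λ T T′ _ complete _ complete′ (I , J) →
    theoryTraceDefines-interprets classical complete′ I ,
    theoryTraceDefines-interprets classical complete J)
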